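{- Let $n\ge 3$ and let $s\ge 1$ be an integer. The set of Nakajima monomials $$\mathcal{M}^{1,s}=\Big\{\prod_{i=1}^n Y_{i-1,1}^{ -x_i}Y_{i,0}^{x_i}\ \Big|\ x_1,\dots,x_n\in\mathbb{Z}_{\ge 0},\ \sum_{i=1}^n x_i=s\Big\}$$ (first indices taken mod $n$), with the functions $\mathrm{wt},\varepsilon_i,\varphi_i$ and operators $e_i,f_i$ ($i\in I$) of the Nakajima monomial crystal structure, is isomorphic to the Kirillov--Reshetikhin crystal $B^{1,s}$ as a $U_q'(\widehat{\mathfrak{sl}}_n)$-crystal.
   Context: Crystals. $I=\mathbb{Z}/n\mathbb{Z}=\{0,1,\dots,n-1\}$ is the index set of $\widehat{\mathfrak{sl}}_n$ (type $A_{n-1}^{(1)}$), with fundamental weights $\Lambda_i$, and simple roots $\alpha_i=2\Lambda_i-\Lambda_{i-1}-\Lambda_{i+1}$ as $U_q'(\widehat{\mathfrak{sl}}_n)$-weights (that is, modulo the null root $\delta$). A $U_q'(\widehat{\mathfrak{sl}}_n)$-crystal is a set $B$ with maps $e_i,f_i:B\to B\sqcup\{0\}$, $\varepsilon_i,\varphi_i:B\to\mathbb{Z}$ and $\mathrm{wt}:B\to\bigoplus_i\mathbb{Z}\Lambda_i$ satisfying the usual crystal axioms. An isomorphism of crystals is a bijection that preserves $\mathrm{wt},\varepsilon_i,\varphi_i$ and commutes with all $e_i,f_i$ (with $0\mapsto 0$). Nakajima monomials. $\mathcal{M}$ is the set of Laurent monomials $m=\prod_{i\in I,k\in\mathbb{Z}}Y_{i,k}^{y_{i,k}}$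 (finitely many nonzero exponents) in commuting variables $Y_{i,k}$. Put $\mathrm{wt}(m)=\sum_{i,k}y_{i,k}\Lambda_i$, $\ \varepsilon_i(m)=-\min_{k\in\mathbb{Z}}\sum_{t\ge k}y_{i,t}$, $\ \varphi_i(m)=\max_{k\in\mathbb{Z}}\sum_{t\le k}y_{i,t}$, $\ k_e(m)=\max\{k\mid \varepsilon_i(m)=-\sum_{t\ge k}y_{i,t}\}$ (used when $\varepsilon_i(m)>0$), $\ k_f(m)=\min\{k\mid\varphi_i(m)=\sum_{t\le k}y_{i,t}\}$ (used when $\varphi_i(m)>0$). With $A_{i,k}=Y_{i,k}Y_{i,k+1}Y_{i-1,k+1}^{ -1}Y_{i+1,k}^{ -1}$, set $e_i(m)=0$ if $\varepsilon_i(m)=0$ and $e_i(m)=m\,A_{i,k_e(m)-1}$ otherwise; $f_i(m)=0$ if $\varphi_i(m)=0$ and $f_i(m)=m\,A_{i,k_f(m)}^{ -1}$ otherwise. The crystal $B^{1,s}$ (vector realization). $B^{1,s}=\{(x_1,\dots,x_n)\in\mathbb{Z}_{\ge0}^n\mid\sum_i x_i=s\}$, with indices mod $n$ (so $x_0=x_n$), and for $i\in I$: $\varepsilon_i(x)=x_{i+1}$, $\varphi_i(x)=x_i$, $\mathrm{wt}(x)=\sum_{i\in I}(x_i-x_{i+1})\Lambda_i$; $e_i(x)=0$ if $x_{i+1}=0$, and otherwise $e_i$ increases $x_i$ by $1$ and decreases $x_{i+1}$ by $1$; $f_i(x)=0$ if $x_i=0$, and otherwise $f_i$ decreases $x_i$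 by $1$ and increases $x_{i+1}$ by $1$. -}

module Defs where

open import Data.Bool.Base using (if_then_else_)
open import Data.Fin.Base as Fin using (Fin; toℕ)
import Data.Fin.Properties as Fin
open import Data.Integer.Base as ℤ using (ℤ; +_; -[1+_]; 0ℤ; 1ℤ; -1ℤ; ∣_∣)
  renaming (suc to sucℤ; pred to predℤ)
import Data.Integer.Properties as ℤ
open import Data.List.Base as List using (List; []; _∷_; filter)
open import Data.List.Extrema ℤ.≤-totalOrder using (min; max)
open import Data.Maybe.Base as Maybe using (Maybe; just; nothing)
open import Data.Maybe.Relation.Binary.Pointwise using (Pointwise)
open import Data.Maybe.Relation.Unary.All as MaybeAll using (just; nothing)
open import Data.Nat.Base as ℕ using (ℕ; zero; suc; _⊔_)
open import Data.Nat.DivMod using (_mod_)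
import Data.Nat.Properties as ℕ
open import Data.Product.Base using (Σ; ∃-syntax; _×_; _,_; proj₁; proj₂)
open import Data.Vec.Base as Vec using (Vec; _∷_; lookup; updateAt)
import Data.Vec.Functional as Fun
open import Function.Bundles using (_⇔_)
open import Function.Definitions using (Congruent; Bijective)
open import Level using (0ℓ)
open import Relation.Binary.Core using (Rel)
open import Relation.Binary.PropositionalEquality
  using (_≡_; _≢_; refl; sym; trans; cong; cong₂)
open import Relation.Binary.Structures using (IsEquivalence)
open import Relation.Nullary.Decidable using (⌊_⌋; yes; no; does; _×-dec_)
open import Relation.Nullary.Negation using (contradiction)
open import Relation.Unary using (Pred; Decidable)

-- The index set ℤ/n is represented by the residues 0, …, n-1.

next prev : ∀ {n} → Fin n → Fin n
next {suc n} i = suc (toℕ i) mod suc n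
prev {suc n} i = (toℕ i ℕ.+ n) mod suc n

-- Weights modulo δ.  The function w stands for Σᵢ w(i) Λᵢ, so that
-- w(i) is also the pairing of w with the simple coroot hᵢ.

Weight : ℕ → Set
Weight n = Fin n → ℤ

Λ : ∀ {n} → Fin n → Weight n
Λ i j = if ⌊ i Fin.≟ j ⌋ then 1ℤ else 0ℤ

α : ∀ {n} → Fin n → Weight n
α i j = + 2 ℤ.* Λ i j ℤ.- Λ (prev i) j ℤ.- Λ (next i) j

-- The underlying set is a setoid, and `nothing` plays the
-- role of the extra element 0 in B ⊔ {0}.

record RawCrystal (n : ℕ) : Set₁ where
  infix 4 _≈_
  field
    Carrier : Set
    _≈_     : Rel Carrier 0ℓ
    wt      : Carrier → Weight n
    ε φ     : Fin n → Carrier → ℤ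
    e f     : Fin n → Carrier → Maybe Carrier

record IsCrystal {n : ℕ} (C : RawCrystal n) : Set where
  open RawCrystal C
  field
    isEquivalence : IsEquivalence _≈_

    wt-cong : ∀ {b b′} → b ≈ b′ → ∀ i → wt b i ≡ wt b′ i
    ε-cong  : ∀ i → Congruent _≈_ _≡_ (ε i)
    φ-cong  : ∀ i → Congruent _≈_ _≡_ (φ i)
    e-cong  : ∀ i → Congruent _≈_ (Pointwise _≈_) (e i)
    f-cong  : ∀ i → Congruent _≈_ (Pointwise _≈_) (f i)

    φ≡ε+wt : ∀ i b → φ i b ≡ ε i b ℤ.+ wt b i

    wt-e : ∀ i {b b′} → e i b ≡ just b′ → ∀ j → wt b′ j ≡ wt b j ℤ.+ α i j
    ε-e  : ∀ i {b b′} → e i b ≡ just b′ → ε i b′ ≡ ε i b ℤ.- 1ℤ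
    φ-e  : ∀ i {b b′} → e i b ≡ just b′ → φ i b′ ≡ φ i b ℤ.+ 1ℤ

    wt-f : ∀ i {b b′} → f i b ≡ just b′ → ∀ j → wt b′ j ≡ wt b j ℤ.- α i j
    ε-f  : ∀ i {b b′} → f i b ≡ just b′ → ε i b′ ≡ ε i b ℤ.+ 1ℤ
    φ-f  : ∀ i {b b′} → f i b ≡ just b′ → φ i b′ ≡ φ i b ℤ.- 1ℤ

    f⇔e : ∀ i b b′ → Pointwise _≈_ (f i b) (just b′) ⇔
                     Pointwise _≈_ (just b) (e i b′)

infix 4 _≅_

record _≅_ {n : ℕ} (C D : RawCrystal n) : Set where
  private
    module C = RawCrystal C
    module D = RawCrystal D
  field
    isCrystalˡ : IsCrystal C
    isCrystalʳ : IsCrystal D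

    to        : C.Carrier → D.Carrier
    to-cong   : Congruent C._≈_ D._≈_ to
    bijective : Bijective C._≈_ D._≈_ to

    wt-to : ∀ b i → D.wt (to b) i ≡ C.wt b i
    ε-to  : ∀ i b → D.ε i (to b) ≡ C.ε i b
    φ-to  : ∀ i b → D.φ i (to b) ≡ C.φ i b
    e-to  : ∀ i b → Pointwise D._≈_ (D.e i (to b)) (Maybe.map to (C.e i b))
    f-to  : ∀ i b → Pointwise D._≈_ (D.f i (to b)) (Maybe.map to (C.f i b))

-- All eᵢ and fᵢ map the subset P to P ⊔ {0}.
Closed : ∀ {n} (C : RawCrystal n) → Pred (RawCrystal.Carrier C) 0ℓ → Set
Closed C P = ∀ i b → P b → MaybeAll.All P (e i b) × MaybeAll.All P (f i b)
  where open RawCrystal C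

attach : ∀ {A : Set} {P : Pred A 0ℓ} (a : Maybe A) → MaybeAll.All P a → Maybe (Σ A P)
attach (just a) (just p) = just (a , p)
attach nothing  nothing  = nothing

restrict : ∀ {n} (C : RawCrystal n) {P : Pred (RawCrystal.Carrier C) 0ℓ} →
           Closed C P → RawCrystal n
restrict C {P} closed = record
  { Carrier = Σ Carrier P
  ; _≈_     = λ b b′ → proj₁ b ≈ proj₁ b′
  ; wt      = λ b → wt (proj₁ b)
  ; ε       = λ i b → ε i (proj₁ b)
  ; φ       = λ i b → φ i (proj₁ b)
  ; e       = λ i (b , p) → attach (e i b) (proj₁ (closed i b p))
  ; f       = λ i (b , p) → attach (f i b) (proj₂ (closed i b p))
  } where open RawCrystal C

-- Laurent monomials in the variables Y i k (i ∈ I, k ∈ ℤ).  Finiteness of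
-- the support is witnessed by a bound, which is not part of the identity
-- of the monomial: _≈ₘ_ only compares exponents.

record Monomial (n : ℕ) : Set where
  field
    exponent : Fin n → ℤ → ℤ
    bound    : ℕ
    vanish   : ∀ i k → bound ℕ.< ∣ k ∣ → exponent i k ≡ 0ℤ

open Monomial public

infix 4 _≈ₘ_

_≈ₘ_ : ∀ {n} → Rel (Monomial n) 0ℓ
m ≈ₘ m′ = ∀ i k → exponent m i k ≡ exponent m′ i k

infixl 7 _·_
infixr 8 _^_

𝟙 : ∀ {n} → Monomial n
𝟙 = record { exponent = λ _ _ → 0ℤ ; bound = 0 ; vanish = λ _ _ _ → refl }

_·_ : ∀ {n} → Monomial n → Monomial n → Monomial n
m · m′ = record
  { exponent = λ i k → exponent m i k ℤ.+ exponent m′ i k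
  ; bound    = bound m ⊔ bound m′
  ; vanish   = λ i k lt → cong₂ ℤ._+_
      (vanish m i k (ℕ.≤-<-trans (ℕ.m≤m⊔n (bound m) (bound m′)) lt))
      (vanish m′ i k (ℕ.≤-<-trans (ℕ.m≤n⊔m (bound m) (bound m′)) lt))
  }

_^_ : ∀ {n} → Monomial n → ℤ → Monomial n
m ^ z = record
  { exponent = λ i k → z ℤ.* exponent m i k
  ; bound    = bound m
  ; vanish   = λ i k lt → trans (cong (z ℤ.*_) (vanish m i k lt)) (ℤ.*-zeroʳ z)
  }

Y : ∀ {n} → Fin n → ℤ → Monomial n
Y i k = record
  { exponent = λ j l → if does ((i Fin.≟ j) ×-dec (k ℤ.≟ l)) then 1ℤ else 0ℤ
  ; bound    = ∣ k ∣
  ; vanish   = outside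
  }
  where
  outside : ∀ j l → ∣ k ∣ ℕ.< ∣ l ∣ →
            (if does ((i Fin.≟ j) ×-dec (k ℤ.≟ l)) then 1ℤ else 0ℤ) ≡ 0ℤ
  outside j l lt with i Fin.≟ j | k ℤ.≟ l
  ... | no  _ | _        = refl
  ... | yes _ | no  _    = refl
  ... | yes _ | yes refl = contradiction lt (ℕ.<-irrefl refl)

A : ∀ {n} → Fin n → ℤ → Monomial n
A i k = Y i k · Y i (sucℤ k) · Y (prev i) (sucℤ k) ^ -1ℤ · Y (next i) k ^ -1ℤ

∏ : ∀ {n l} → (Fin l → Monomial n) → Monomial n
∏ = Fun.foldr _·_ 𝟙

-- The integers k with ∣ k ∣ ≤ N.
window : ℕ → List ℤ
window zero    = 0ℤ ∷ []
window (suc N) = + suc N ∷ -[1+ N ] ∷ window N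

∑ : List ℤ → ℤ
∑ = List.foldr ℤ._+_ 0ℤ

-- Sum of the exponents of Y i t over all t ∈ ℤ satisfying a given predicate;
-- those with t outside the window vanish.
∑Y : ∀ {n} → Monomial n → Fin n → {P : Pred ℤ 0ℓ} → Decidable P → ℤ
∑Y m i P? = ∑ (List.map (exponent m i) (filter P? (window (bound m))))

∑≥ ∑≤ : ∀ {n} → Fin n → Monomial n → ℤ → ℤ
∑≥ i m k = ∑Y m i (λ t → k ℤ.≤? t)
∑≤ i m k = ∑Y m i (λ t → t ℤ.≤? k)

-- As functions of k, both partial sums are constant above and below this
-- range, so it suffices for the extrema over all k ∈ ℤ.
range : ∀ {n} → Monomial n → List ℤ
range m = window (suc (bound m))

wtₘ : ∀ {n} → Monomial n → Weight n
wtₘ m i = ∑ (List.map (exponent m i) (window (bound m)))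

-- The default value 0 of min and max is the partial sum for k ≫ 0,
-- respectively k ≪ 0.
εₘ φₘ : ∀ {n} → Fin n → Monomial n → ℤ
εₘ i m = ℤ.- min 0ℤ (List.map (∑≥ i m) (range m))
φₘ i m = max 0ℤ (List.map (∑≤ i m) (range m))

-- Meaningful only if εₘ i m > 0, respectively φₘ i m > 0; then the filtered
-- list is nonempty and the default value does not matter.
kᵉ kᶠ : ∀ {n} → Fin n → Monomial n → ℤ
kᵉ i m = max -[1+ bound m ]    (filter (λ k → εₘ i m ℤ.≟ ℤ.- ∑≥ i m k) (range m))
kᶠ i m = min (+ suc (bound m)) (filter (λ k → φₘ i m ℤ.≟ ∑≤ i m k) (range m))

eₘ fₘ : ∀ {n} → Fin n → Monomial n → Maybe (Monomial n)
eₘ i m = if ⌊ εₘ i m ℤ.≟ 0ℤ ⌋ then nothing else just (m · A i (predℤ (kᵉ i m)))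
fₘ i m = if ⌊ φₘ i m ℤ.≟ 0ℤ ⌋ then nothing else just (m · A i (kᶠ i m) ^ -1ℤ)

𝓜 : ∀ n → RawCrystal n
𝓜 n = record
  { Carrier = Monomial n ; _≈_ = _≈ₘ_
  ; wt = wtₘ ; ε = εₘ ; φ = φₘ ; e = eₘ ; f = fₘ }

-- A tuple (x₁, …, xₙ) is stored by the residues of its indices mod n, so
-- that entry 0 of the vector is xₙ = x₀.
monomial : ∀ {n} → Vec ℕ n → Monomial n
monomial x = ∏ λ i → Y (prev i) 1ℤ ^ (ℤ.- + lookup x i) · Y i 0ℤ ^ (+ lookup x i)

𝓜¹ : ∀ n → ℕ → Pred (Monomial n) 0ℓ
𝓜¹ n s m = ∃[ x ] Vec.sum x ≡ s × m ≈ₘ monomial x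

-- The Kirillov–Reshetikhin crystal B¹ˢ, with tuples stored in the same way

εᵥ φᵥ : ∀ {n} → Fin n → Vec ℕ n → ℤ
εᵥ i x = + lookup x (next i)
φᵥ i x = + lookup x i

eᵥ fᵥ : ∀ {n} → Fin n → Vec ℕ n → Maybe (Vec ℕ n)
eᵥ i x = if ⌊ lookup x (next i) ℕ.≟ 0 ⌋ then nothing
         else just (updateAt (updateAt x i suc) (next i) ℕ.pred)
fᵥ i x = if ⌊ lookup x i ℕ.≟ 0 ⌋ then nothing
         else just (updateAt (updateAt x i ℕ.pred) (next i) suc)

tuples : ∀ n → RawCrystal n
tuples n = record
  { Carrier = Vec ℕ n ; _≈_ = _≡_
  ; wt = λ x i → + lookup x i ℤ.- + lookup x (next i)
  ; ε = εᵥ ; φ = φᵥ ; e = eᵥ ; f = fᵥ }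

module _ where
  private
    sum-suc : ∀ {n} (x : Vec ℕ n) i → Vec.sum (updateAt x i suc) ≡ suc (Vec.sum x)
    sum-suc (a ∷ x) Fin.zero    = refl
    sum-suc (a ∷ x) (Fin.suc i) = trans (cong (a ℕ.+_) (sum-suc x i)) (ℕ.+-suc a _)

    sum-pred : ∀ {n} (x : Vec ℕ n) i → lookup x i ≢ 0 →
               suc (Vec.sum (updateAt x i ℕ.pred)) ≡ Vec.sum x
    sum-pred (zero  ∷ x) Fin.zero    ≢0 = contradiction refl ≢0
    sum-pred (suc a ∷ x) Fin.zero    ≢0 = refl
    sum-pred (a     ∷ x) (Fin.suc i) ≢0 =
      trans (sym (ℕ.+-suc a _)) (cong (a ℕ.+_) (sum-pred x i ≢0))

    lookup-suc : ∀ {n} (x : Vec ℕ n) i j → lookup x j ≢ 0 →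
                 lookup (updateAt x i suc) j ≢ 0
    lookup-suc (a ∷ x) Fin.zero    Fin.zero    ≢0 = λ ()
    lookup-suc (a ∷ x) Fin.zero    (Fin.suc j) ≢0 = ≢0
    lookup-suc (a ∷ x) (Fin.suc i) Fin.zero    ≢0 = ≢0
    lookup-suc (a ∷ x) (Fin.suc i) (Fin.suc j) ≢0 = lookup-suc x i j ≢0

  tuples-closed : ∀ n s → Closed (tuples n) (λ x → Vec.sum x ≡ s)
  tuples-closed n s i x refl = e-closed , f-closed
    where
    e-closed : MaybeAll.All (λ y → Vec.sum y ≡ s) (eᵥ i x)
    e-closed with lookup x (next i) ℕ.≟ 0
    ... | yes _  = nothing
    ... | no  ≢0 = just (ℕ.suc-injective
      (trans (sum-pred (updateAt x i suc) (next i) (lookup-suc x i (next i) ≢0))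
             (sum-suc x i)))

    f-closed : MaybeAll.All (λ y → Vec.sum y ≡ s) (fᵥ i x)
    f-closed with lookup x i ℕ.≟ 0
    ... | yes _  = nothing
    ... | no  ≢0 = just (trans (sum-suc (updateAt x i ℕ.pred) (next i)) (sum-pred x i ≢0))

B¹ : ∀ n → ℕ → RawCrystal n
B¹ n s = restrict (tuples n) (tuples-closed n s)

{-# OPTIONS --safe #-}

-- In the monomial of x, the exponents of Yᵢ,₀ and Yᵢ,₁ are xᵢ and −xᵢ₊₁, and
-- those of all other Yᵢ,ₖ vanish.  So the partial sums over t ≤ k are 0, xᵢ and
-- xᵢ − xᵢ₊₁, whence φᵢ = xᵢ, first attained at k = 0; dually εᵢ = xᵢ₊₁, last
-- attained at k = 1.  Both operators therefore multiply by Aᵢ,₀^±¹, and Aᵢ,₀ is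
-- the monomial of uᵢ − uᵢ₊₁, where the uᵢ are the unit vectors.  The crystal
-- axioms are checked for tuples only, and transported to monomials.

module Submission where

open import Defs
open import Data.Bool.Base using (true; false; if_then_else_)
open import Data.Fin.Base as Fin using (Fin; toℕ)
import Data.Fin.Properties as Fin
open import Data.Integer.Base as ℤ using (ℤ; +_; -[1+_]; 0ℤ; 1ℤ; -≤+; +≤+)
import Data.Integer.Properties as ℤ
open import Data.Integer.Tactic.RingSolver using (solve-∀)
open import Data.List.Base as List using ([]; _∷_; filter)
open import Data.List.Extrema ℤ.≤-totalOrder using (min≈v⁺; max≈v⁺)
open import Data.List.Membership.Propositional using (_∈_)
open import Data.List.Membership.Propositional.Properties using (∈-map⁺; ∈-filter⁺)
open import Data.List.Properties using (filter-all)
open import Data.List.Relation.Unary.All as All using ()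
import Data.List.Relation.Unary.All.Properties as All
open import Data.List.Relation.Unary.Any using (here; there)
open import Data.Maybe.Base as Maybe using (Maybe; just; nothing)
open import Data.Maybe.Relation.Binary.Pointwise as Pointwise using (Pointwise; just; nothing)
open import Data.Maybe.Relation.Unary.All as MaybeAll using (just; nothing)
open import Data.Nat.Base as ℕ using (ℕ; zero; suc; _≤_; s≤s; z≤n)
open import Data.Nat.DivMod
  using (_%_; n%n≡0; m%n%n≡m%n; [m+n]%n≡m%n; m<n⇒m%n≡m; %-distribˡ-+)
import Data.Nat.Properties as ℕ
open import Data.Product.Base using (Σ-syntax; ∃-syntax; _×_; _,_; proj₁; proj₂)
open import Data.Sum.Base using (inj₁; inj₂)
open import Data.Unit.Base using (⊤; tt)
open import Data.Vec.Base as Vec using (Vec; lookup; updateAt)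
import Data.Vec.Properties as Vec
open import Function.Base using (_∘_)
open import Function.Bundles using (_⇔_; mk⇔; Equivalence)
open import Function.Definitions using (Congruent; Injective)
open import Level using (0ℓ)
open import Relation.Binary.Core using (Rel; REL)
import Relation.Binary.Construct.On as On
open import Relation.Binary.PropositionalEquality as ≡
  using (_≡_; _≢_; refl; sym; trans; cong; cong₂; subst; module ≡-Reasoning)
open import Relation.Binary.Structures using (IsEquivalence)
open import Relation.Nullary.Decidable using (Dec; yes; no; does; isYes)
open import Relation.Nullary.Negation using (¬_; contradiction)
open import Relation.Unary using (Pred; Decidable)

-- Restriction of a crystal to a closed subset

module _ {A B : Set} {P : Pred A 0ℓ} {Q : Pred B 0ℓ} {R : REL A B 0ℓ} where

  -- `attach` only adds membership proofs, which the relation on a restricted carrier ignores. So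
  -- the axioms about `e` and `f` pass to the restriction through `attach⁺` and `attach⁻`.
  attach⁺ : ∀ {a b} (p : MaybeAll.All P a) (q : MaybeAll.All Q b) → Pointwise R a b →
            Pointwise (λ u v → R (proj₁ u) (proj₁ v)) (attach a p) (attach b q)
  attach⁺ (just _) (just _) (just r) = just r
  attach⁺ nothing  nothing  nothing  = nothing

  attach⁻ : ∀ {a b} (p : MaybeAll.All P a) (q : MaybeAll.All Q b) →
            Pointwise (λ u v → R (proj₁ u) (proj₁ v)) (attach a p) (attach b q) →
            Pointwise R a b
  attach⁻ (just _) (just _) (just r) = just r
  attach⁻ nothing  nothing  nothing  = nothing

attach-just : ∀ {A : Set} {P : Pred A 0ℓ} {a : Maybe A} (p : MaybeAll.All P a) {b} →
              attach a p ≡ just b → a ≡ just (proj₁ b)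
attach-just (just _) refl = refl

restrict-isCrystal : ∀ {n} {C : RawCrystal n} {P : Pred (RawCrystal.Carrier C) 0ℓ} →
                     IsCrystal C → (closed : Closed C P) → IsCrystal (restrict C closed)
restrict-isCrystal {C = C} isCrystal closed = record
  { isEquivalence = On.isEquivalence proj₁ isEquivalence
  ; wt-cong = wt-cong
  ; ε-cong  = λ i → ε-cong i
  ; φ-cong  = λ i → φ-cong i
  ; e-cong  = λ i → attach⁺ _ _ ∘ e-cong i
  ; f-cong  = λ i → attach⁺ _ _ ∘ f-cong i
  ; φ≡ε+wt  = λ i b → φ≡ε+wt i (proj₁ b)
  ; wt-e = λ i → wt-e i ∘ attach-just _
  ; ε-e  = λ i → ε-e i ∘ attach-just _
  ; φ-e  = λ i → φ-e i ∘ attach-just _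
  ; wt-f = λ i → wt-f i ∘ attach-just _
  ; ε-f  = λ i → ε-f i ∘ attach-just _
  ; φ-f  = λ i → φ-f i ∘ attach-just _
  ; f⇔e = λ i (b , p) (b′ , p′) →
      let f-closed = proj₂ (closed i b p)
          e-closed = proj₁ (closed i b′ p′)
      in mk⇔ (attach⁺ (just p) e-closed ∘ Equivalence.to (f⇔e i b b′) ∘ attach⁻ f-closed (just p′))
             (attach⁺ f-closed (just p′) ∘ Equivalence.from (f⇔e i b b′) ∘ attach⁻ (just p) e-closed)
  } where open IsCrystal isCrystal

-- Pulling the crystal axioms back along an embedding

module _ {n} (C D : RawCrystal n) where

  private
    module C = RawCrystal C
    module D = RawCrystal D

  module Embedding
    (isCrystal : IsCrystal D) (isEquivalence : IsEquivalence C._≈_)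
    (to : C.Carrier → D.Carrier)
    (to-cong : Congruent C._≈_ D._≈_ to) (to-injective : Injective C._≈_ D._≈_ to)
    (wt-to : ∀ b i → D.wt (to b) i ≡ C.wt b i)
    (ε-to  : ∀ i b → D.ε i (to b) ≡ C.ε i b)
    (φ-to  : ∀ i b → D.φ i (to b) ≡ C.φ i b)
    (e-to  : ∀ i b → Pointwise D._≈_ (D.e i (to b)) (Maybe.map to (C.e i b)))
    (f-to  : ∀ i b → Pointwise D._≈_ (D.f i (to b)) (Maybe.map to (C.f i b)))
    where

    private
      module D′ = IsCrystal isCrystal
      module ≈ = IsEquivalence D′.isEquivalence

      ≈-sym : ∀ {a b} → Pointwise D._≈_ a b → Pointwise D._≈_ b a
      ≈-sym = Pointwise.sym ≈.sym

      ≈-trans : ∀ {a b c} → Pointwise D._≈_ a b → Pointwise D._≈_ b c → Pointwise D._≈_ a c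
      ≈-trans = Pointwise.trans ≈.trans

      map-to⁺ : ∀ {a b} → Pointwise C._≈_ a b → Pointwise D._≈_ (Maybe.map to a) (Maybe.map to b)
      map-to⁺ (just p) = just (to-cong p)
      map-to⁺ nothing  = nothing

      map-to⁻ : ∀ a b → Pointwise D._≈_ (Maybe.map to a) (Maybe.map to b) → Pointwise C._≈_ a b
      map-to⁻ (just _) (just _) (just p) = just (to-injective p)
      map-to⁻ nothing  nothing  nothing  = nothing

      -- The axioms for `D` speak of an actual result of its operator, whereas `e-to` and `f-to`
      -- determine that result only up to `D._≈_`. This produces the result `d` together with its
      -- comparison to `to b′`.
      image : ∀ {a b} → Pointwise D._≈_ a (Maybe.map to b) → ∀ {b′} → b ≡ just b′ →
              ∃[ d ] a ≡ just d × d D.≈ to b′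
      image (just p) refl = _ , refl , p

      -- Subtraction unfolds to adding the negative, so one increment `w` serves both operators:
      -- `α i` for `e`, its negative for `f`. The same holds for `z` in `ε-via` and `φ-via`.
      wt-via : ∀ {b b′ d} (w : Weight n) → d D.≈ to b′ →
               (∀ j → D.wt d j ≡ D.wt (to b) j ℤ.+ w j) →
               ∀ j → C.wt b′ j ≡ C.wt b j ℤ.+ w j
      wt-via {b} {b′} w p eq j = trans (sym (wt-to b′ j))
        (trans (sym (D′.wt-cong p j)) (trans (eq j) (cong (ℤ._+ w j) (wt-to b j))))

      ε-via : ∀ i {b b′ d z} → d D.≈ to b′ → D.ε i d ≡ D.ε i (to b) ℤ.+ z →
              C.ε i b′ ≡ C.ε i b ℤ.+ z
      ε-via i {b} {b′} {z = z} p eq = trans (sym (ε-to i b′))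
        (trans (sym (D′.ε-cong i p)) (trans eq (cong (ℤ._+ z) (ε-to i b))))

      φ-via : ∀ i {b b′ d z} → d D.≈ to b′ → D.φ i d ≡ D.φ i (to b) ℤ.+ z →
              C.φ i b′ ≡ C.φ i b ℤ.+ z
      φ-via i {b} {b′} {z = z} p eq = trans (sym (φ-to i b′))
        (trans (sym (D′.φ-cong i p)) (trans eq (cong (ℤ._+ z) (φ-to i b))))

    -- Numerical axioms are read off in `D` at the image; statements about operators return to `C`
    -- by injectivity. The congruences come along too: for monomials this yields that `εₘ`, `φₘ`,
    -- `eₘ` and `fₘ` respect `_≈ₘ_` although they are computed from the chosen `bound`.
    isCrystal-via-embedding : IsCrystal C
    isCrystal-via-embedding = record
      { isEquivalence = isEquivalence
      ; wt-cong = λ {b} {b′} p j →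
          trans (sym (wt-to b j)) (trans (D′.wt-cong (to-cong p) j) (wt-to b′ j))
      ; ε-cong = λ i {b} {b′} p →
          trans (sym (ε-to i b)) (trans (D′.ε-cong i (to-cong p)) (ε-to i b′))
      ; φ-cong = λ i {b} {b′} p →
          trans (sym (φ-to i b)) (trans (D′.φ-cong i (to-cong p)) (φ-to i b′))
      ; e-cong = λ i {b} {b′} p → map-to⁻ _ _
          (≈-trans (≈-sym (e-to i b)) (≈-trans (D′.e-cong i (to-cong p)) (e-to i b′)))
      ; f-cong = λ i {b} {b′} p → map-to⁻ _ _
          (≈-trans (≈-sym (f-to i b)) (≈-trans (D′.f-cong i (to-cong p)) (f-to i b′)))
      ; φ≡ε+wt = λ i b → trans (sym (φ-to i b))
          (trans (D′.φ≡ε+wt i (to b)) (cong₂ ℤ._+_ (ε-to i b) (wt-to b i)))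
      ; wt-e = λ i {b} {b′} eq → let _ , eq′ , p = image (e-to i b) eq in
          wt-via {b} {b′} (α i) p (D′.wt-e i eq′)
      ; ε-e = λ i {b} eq → let _ , eq′ , p = image (e-to i b) eq in ε-via i p (D′.ε-e i eq′)
      ; φ-e = λ i {b} eq → let _ , eq′ , p = image (e-to i b) eq in φ-via i p (D′.φ-e i eq′)
      ; wt-f = λ i {b} {b′} eq → let _ , eq′ , p = image (f-to i b) eq in
          wt-via {b} {b′} (λ j → ℤ.- α i j) p (D′.wt-f i eq′)
      ; ε-f = λ i {b} eq → let _ , eq′ , p = image (f-to i b) eq in ε-via i p (D′.ε-f i eq′)
      ; φ-f = λ i {b} eq → let _ , eq′ , p = image (f-to i b) eq in φ-via i p (D′.φ-f i eq′)
      ; f⇔e = λ i b b′ → mk⇔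
          (λ p → map-to⁻ (just b) _
            (≈-trans (Equivalence.to (D′.f⇔e i (to b) (to b′)) (≈-trans (f-to i b) (map-to⁺ p))) (e-to i b′)))
          (λ p → map-to⁻ _ (just b′)
            (≈-trans (≈-sym (f-to i b)) (Equivalence.from (D′.f⇔e i (to b) (to b′)) (≈-trans (map-to⁺ p) (≈-sym (e-to i b′))))))
      }

-- Cyclic indices and fundamental weights

-- For modulus `suc n`, adding `n` amounts to subtracting 1. The composite adds `suc n` in total,
-- which disappears modulo `suc n`.
next-prev : ∀ {n} (i : Fin n) → next (prev i) ≡ i
next-prev {suc n} i = Fin.toℕ-injective (begin
  toℕ (next (prev i))                       ≡⟨ Fin.toℕ-fromℕ< _ ⟩
  suc (toℕ (prev i)) % suc n                ≡⟨ cong (λ k → suc k % suc n) (Fin.toℕ-fromℕ< _) ⟩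
  suc ((toℕ i ℕ.+ n) % suc n) % suc n       ≡⟨ suc-% (toℕ i ℕ.+ n) ⟩
  suc (toℕ i ℕ.+ n) % suc n                 ≡⟨ cong (_% suc n) (ℕ.+-suc (toℕ i) n) ⟨
  (toℕ i ℕ.+ suc n) % suc n                 ≡⟨ [m+n]%n≡m%n (toℕ i) (suc n) ⟩
  toℕ i % suc n                             ≡⟨ m<n⇒m%n≡m (Fin.toℕ<n i) ⟩
  toℕ i                                     ∎)
  where
  open ≡-Reasoning
  suc-% : ∀ m → suc (m % suc n) % suc n ≡ suc m % suc n
  suc-% m = begin
    (1 ℕ.+ m % suc n) % suc n                        ≡⟨ %-distribˡ-+ 1 (m % suc n) (suc n) ⟩
    (1 % suc n ℕ.+ m % suc n % suc n) % suc n
      ≡⟨ cong (λ k → (1 % suc n ℕ.+ k) % suc n) (m%n%n≡m%n m (suc n)) ⟩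
    (1 % suc n ℕ.+ m % suc n) % suc n                ≡⟨ %-distribˡ-+ 1 m (suc n) ⟨
    (1 ℕ.+ m) % suc n                                ∎

prev-next : ∀ {n} (i : Fin n) → prev (next i) ≡ i
prev-next {suc n} i = Fin.toℕ-injective (begin
  toℕ (prev (next i))                       ≡⟨ Fin.toℕ-fromℕ< _ ⟩
  (toℕ (next i) ℕ.+ n) % suc n
    ≡⟨ cong (λ k → (k ℕ.+ n) % suc n) {y = suc (toℕ i) % suc n} (Fin.toℕ-fromℕ< _) ⟩
  (suc (toℕ i) % suc n ℕ.+ n) % suc n       ≡⟨ %-+ (suc (toℕ i)) ⟩
  (suc (toℕ i) ℕ.+ n) % suc n               ≡⟨ cong (_% suc n) (ℕ.+-suc (toℕ i) n) ⟨
  (toℕ i ℕ.+ suc n) % suc n                 ≡⟨ [m+n]%n≡m%n (toℕ i) (suc n) ⟩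
  toℕ i % suc n                             ≡⟨ m<n⇒m%n≡m (Fin.toℕ<n i) ⟩
  toℕ i                                     ∎)
  where
  open ≡-Reasoning
  %-+ : ∀ m → (m % suc n ℕ.+ n) % suc n ≡ (m ℕ.+ n) % suc n
  %-+ m = begin
    (m % suc n ℕ.+ n) % suc n                        ≡⟨ %-distribˡ-+ (m % suc n) n (suc n) ⟩
    (m % suc n % suc n ℕ.+ n % suc n) % suc n
      ≡⟨ cong (λ k → (k ℕ.+ n % suc n) % suc n) (m%n%n≡m%n m (suc n)) ⟩
    (m % suc n ℕ.+ n % suc n) % suc n                ≡⟨ %-distribˡ-+ m n (suc n) ⟨
    (m ℕ.+ n) % suc n                                ∎

next-≢ : ∀ {n} → 2 ≤ n → (i : Fin n) → next i ≢ i
next-≢ {suc zero}    (s≤s ())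
-- Either the successor stays below the modulus and exceeds `toℕ i` by 1, or it wraps around to 0
-- while `toℕ i` is the last residue `suc n`.
next-≢ {suc (suc n)} _ i eq with ℕ.m≤n⇒m<n∨m≡n (Fin.toℕ<n i)
... | inj₁ <n = ℕ.1+n≢n (trans (sym (m<n⇒m%n≡m <n)) (trans (sym (Fin.toℕ-fromℕ< _)) (cong toℕ eq)))
... | inj₂ ≡n = ℕ.1+n≢0 (trans (sym (ℕ.suc-injective ≡n))
  (trans (cong toℕ (sym eq)) (trans (Fin.toℕ-fromℕ< _)
    (trans (cong (_% suc (suc n)) ≡n) (n%n≡0 (suc (suc n)))))))

next-injective : ∀ {n} {i j : Fin n} → next i ≡ next j → i ≡ j
next-injective {i = i} {j} eq = trans (sym (prev-next i)) (trans (cong prev eq) (prev-next j))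

Λ-same : ∀ {n} (i : Fin n) → Λ i i ≡ 1ℤ
Λ-same i with i Fin.≟ i
... | yes _  = refl
... | no i≢i = contradiction refl i≢i

Λ-distinct : ∀ {n} {i j : Fin n} → i ≢ j → Λ i j ≡ 0ℤ
Λ-distinct {i = i} {j} i≢j with i Fin.≟ j
... | yes i≡j = contradiction i≡j i≢j
... | no _    = refl

Λ-next : ∀ {n} (i j : Fin n) → Λ (next i) (next j) ≡ Λ i j
Λ-next i j with i Fin.≟ j
... | yes refl = Λ-same (next i)
... | no i≢j   = Λ-distinct (i≢j ∘ next-injective)

-- `α` and `A` involve `prev`, tuples only `next`; this translates between them.
Λ-prev : ∀ {n} (i j : Fin n) → Λ (prev i) j ≡ Λ i (next j)
Λ-prev i j = trans (sym (Λ-next (prev i) j)) (cong (λ k → Λ k (next j)) (next-prev i))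

-- The crystal of tuples

-- In terms of the unit vectors: y = x + uᵢ − uᵢ₊₁.
Shift : ∀ {n} → Fin n → Rel (Vec ℕ n) 0ℓ
Shift i x y = ∀ j → + lookup y j ≡ + lookup x j ℤ.+ (Λ i j ℤ.- Λ (next i) j)

lookup-injective : ∀ {n} {x y : Vec ℕ n} → (∀ j → lookup x j ≡ lookup y j) → x ≡ y
lookup-injective {x = x} {y} eq =
  trans (sym (Vec.tabulate∘lookup x)) (trans (Vec.tabulate-cong eq) (Vec.tabulate∘lookup y))

lookup-suc : ∀ {n} i (x : Vec ℕ n) j → + lookup (updateAt x i suc) j ≡ + lookup x j ℤ.+ Λ i j
lookup-suc i x j with i Fin.≟ j
... | yes refl = cong +_ (trans (Vec.lookup∘updateAt i x) (sym (ℕ.+-comm _ 1)))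
... | no i≢j   = trans (cong +_ (Vec.lookup∘updateAt′ j i (i≢j ∘ sym) x)) (sym (ℤ.+-identityʳ _))

lookup-pred : ∀ {n} i (x : Vec ℕ n) → lookup x i ≢ 0 → ∀ j →
              + lookup (updateAt x i ℕ.pred) j ≡ + lookup x j ℤ.- Λ i j
lookup-pred i x ≢0 j with i Fin.≟ j
... | yes refl = trans (cong +_ (Vec.lookup∘updateAt i x)) (pred≡-1 (lookup x i) ≢0)
  where
  pred≡-1 : ∀ a → a ≢ 0 → + ℕ.pred a ≡ + a ℤ.- 1ℤ
  pred≡-1 zero    ≢0 = contradiction refl ≢0
  pred≡-1 (suc a) _  = refl
... | no i≢j   = trans (cong +_ (Vec.lookup∘updateAt′ j i (i≢j ∘ sym) x)) (sym (ℤ.+-identityʳ _))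

a≡b+c⇒b≡a-c : ∀ {a b} c → a ≡ b ℤ.+ c → b ≡ a ℤ.- c
a≡b+c⇒b≡a-c {b = b} c refl = cancel b c
  where
  cancel : ∀ b c → b ≡ b ℤ.+ c ℤ.- c
  cancel = solve-∀

-- With `Shift-injective`, this makes `Shift i` a partial bijection, whose two directions turn out
-- to be `eᵥ i` and `fᵥ i`.
Shift-functional : ∀ {n} {i} {x y z : Vec ℕ n} → Shift i x y → Shift i x z → y ≡ z
Shift-functional xy xz = lookup-injective λ j → ℤ.+-injective (trans (xy j) (sym (xz j)))

Shift-injective : ∀ {n} {i} {x y z : Vec ℕ n} → Shift i x z → Shift i y z → x ≡ y
Shift-injective {i = i} xz yz = lookup-injective λ j →
  ℤ.+-injective (trans (a≡b+c⇒b≡a-c (Λ i j ℤ.- Λ (next i) j) (xz j))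
                       (sym (a≡b+c⇒b≡a-c (Λ i j ℤ.- Λ (next i) j) (yz j))))

module _ {n} (2≤n : 2 ≤ n) (i : Fin n) (x y : Vec ℕ n) (shift : Shift i x y) where

  Shift-i : + lookup y i ≡ + lookup x i ℤ.+ 1ℤ
  Shift-i = trans (shift i)
    (cong (ℤ._+_ (+ lookup x i)) (cong₂ ℤ._-_ (Λ-same i) (Λ-distinct (next-≢ 2≤n i))))

  Shift-next : + lookup y (next i) ≡ + lookup x (next i) ℤ.- 1ℤ
  Shift-next = trans (shift (next i))
    (cong (ℤ._+_ (+ lookup x (next i)))
      (cong₂ ℤ._-_ (Λ-distinct (next-≢ 2≤n i ∘ sym)) (Λ-same (next i))))

module _ {n} (i : Fin n) (x : Vec ℕ n) where

  e-Shift : i ≢ next i → lookup x (next i) ≢ 0 →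
            Shift i x (updateAt (updateAt x i suc) (next i) ℕ.pred)
  e-Shift i≢ ≢0 j = trans
    (lookup-pred (next i) (updateAt x i suc)
      -- `ℕ.pred` must not truncate: incrementing entry `i` leaves the entry at `next i` as it was,
      -- hence nonzero.
      (≢0 ∘ trans (sym (Vec.lookup∘updateAt′ (next i) i (i≢ ∘ sym) x))) j)
    (trans (cong (ℤ._- Λ (next i) j) (lookup-suc i x j)) (ℤ.+-assoc (+ lookup x j) (Λ i j) _))

  f-Shift : lookup x i ≢ 0 → Shift i (updateAt (updateAt x i ℕ.pred) (next i) suc) x
  f-Shift ≢0 j = sym (trans
    (cong (ℤ._+ (Λ i j ℤ.- Λ (next i) j))
      (trans (lookup-suc (next i) (updateAt x i ℕ.pred) j)
        (cong (ℤ._+ Λ (next i) j) (lookup-pred i x ≢0 j))))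
    (cancel (+ lookup x j) (Λ i j) (Λ (next i) j)))
    where
    cancel : ∀ a b c → a ℤ.- b ℤ.+ c ℤ.+ (b ℤ.- c) ≡ a
    cancel = solve-∀

module _ {n} (2≤n : 2 ≤ n) (i : Fin n) (x y : Vec ℕ n) where

  -- Once both operators are expressed by the same relation, the axiom `f⇔e` is immediate and each
  -- axiom for `f` is one for `e` read backwards.
  eᵥ⇔Shift : eᵥ i x ≡ just y ⇔ Shift i x y
  eᵥ⇔Shift = mk⇔ to from
    where
    to : eᵥ i x ≡ just y → Shift i x y
    to eq with lookup x (next i) ℕ.≟ 0 | eq
    ... | no ≢0 | refl = e-Shift i x (next-≢ 2≤n i ∘ sym) ≢0

    from : Shift i x y → eᵥ i x ≡ just y
    from shift with lookup x (next i) ℕ.≟ 0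
    -- The shift would give `y` the entry -1, which is not a natural number.
    ... | yes ≡0 with () ← trans (Shift-next 2≤n i x y shift) (cong (λ a → + a ℤ.- 1ℤ) ≡0)
    ... | no ≢0  = cong just
      (Shift-functional {i = i} {x} {z = y} (e-Shift i x (next-≢ 2≤n i ∘ sym) ≢0) shift)

  fᵥ⇔Shift : fᵥ i y ≡ just x ⇔ Shift i x y
  fᵥ⇔Shift = mk⇔ to from
    where
    to : fᵥ i y ≡ just x → Shift i x y
    to eq with lookup y i ℕ.≟ 0 | eq
    ... | no ≢0 | refl = f-Shift i y ≢0

    from : Shift i x y → fᵥ i y ≡ just x
    from shift with lookup y i ℕ.≟ 0
    ... | yes ≡0 = contradiction
      (trans (sym (ℕ.+-comm (lookup x i) 1))
        (ℤ.+-injective (trans (sym (Shift-i 2≤n i x y shift)) (cong +_ ≡0))))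
      ℕ.1+n≢0
    ... | no ≢0  = cong just (Shift-injective {i = i} {y = x} {y} (f-Shift i y ≢0) shift)

  -- Taking differences of neighbouring entries turns uᵢ - uᵢ₊₁ into Λᵢ - Λᵢ₊₁ - Λᵢ₋₁ + Λᵢ, because
  -- the unit vectors are themselves given by `Λ` and `Λ i (next j)` is `Λ (prev i) j`.
  Shift-wt : Shift i x y → ∀ j →
             RawCrystal.wt (tuples n) y j ≡ RawCrystal.wt (tuples n) x j ℤ.+ α i j
  Shift-wt shift j = begin
    + lookup y j ℤ.- + lookup y (next j)
      ≡⟨ cong₂ ℤ._-_ (shift j) (shift (next j)) ⟩
    (xⱼ ℤ.+ (Λ i j ℤ.- Λ (next i) j)) ℤ.- (xⱼ₊₁ ℤ.+ (Λ i (next j) ℤ.- Λ (next i) (next j)))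
      ≡⟨ cong₂ (λ a b → (xⱼ ℤ.+ (Λ i j ℤ.- Λ (next i) j)) ℤ.- (xⱼ₊₁ ℤ.+ (a ℤ.- b)))
           (sym (Λ-prev i j)) (Λ-next i j) ⟩
    (xⱼ ℤ.+ (Λ i j ℤ.- Λ (next i) j)) ℤ.- (xⱼ₊₁ ℤ.+ (Λ (prev i) j ℤ.- Λ i j))
      ≡⟨ rearrange xⱼ xⱼ₊₁ (Λ i j) (Λ (next i) j) (Λ (prev i) j) ⟩
    xⱼ ℤ.- xⱼ₊₁ ℤ.+ α i j ∎
    where
    open ≡-Reasoning
    xⱼ xⱼ₊₁ : ℤ
    xⱼ = + lookup x j
    xⱼ₊₁ = + lookup x (next j)
    rearrange : ∀ a b c d e → (a ℤ.+ (c ℤ.- d)) ℤ.- (b ℤ.+ (e ℤ.- c)) ≡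
                              a ℤ.- b ℤ.+ (+ 2 ℤ.* c ℤ.- e ℤ.- d)
    rearrange = solve-∀

tuples-isCrystal : ∀ {n} → 2 ≤ n → IsCrystal (tuples n)
tuples-isCrystal {n} 2≤n = record
  { isEquivalence = ≡.isEquivalence
  ; wt-cong = λ { refl _ → refl }
  ; ε-cong  = λ { _ refl → refl }
  ; φ-cong  = λ { _ refl → refl }
  ; e-cong  = λ { _ refl → Pointwise.refl refl }
  ; f-cong  = λ { _ refl → Pointwise.refl refl }
  ; φ≡ε+wt  = λ i x → φ≡ε+φ-ε (+ lookup x i) (+ lookup x (next i))
  ; wt-e = λ i {x} {y} eq → Shift-wt 2≤n i x y (e⇒Shift i x y eq)
  ; ε-e  = λ i {x} {y} eq → Shift-next 2≤n i x y (e⇒Shift i x y eq)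
  ; φ-e  = λ i {x} {y} eq → Shift-i 2≤n i x y (e⇒Shift i x y eq)
  -- The `f` axioms solve the `e` identities for the other side. In `ε-f` the constant -1 is
  -- subtracted, and the double negation computes to 1.
  ; wt-f = λ i {y} {x} eq j → a≡b+c⇒b≡a-c (α i j) (Shift-wt 2≤n i x y (f⇒Shift i x y eq) j)
  ; ε-f  = λ i {y} {x} eq → a≡b+c⇒b≡a-c (ℤ.- 1ℤ) (Shift-next 2≤n i x y (f⇒Shift i x y eq))
  ; φ-f  = λ i {y} {x} eq → a≡b+c⇒b≡a-c 1ℤ (Shift-i 2≤n i x y (f⇒Shift i x y eq))
  ; f⇔e = λ i y x → mk⇔
      (λ p → ≡⇒Pointwise (sym
        (Equivalence.from (eᵥ⇔Shift 2≤n i x y) (f⇒Shift i x y (Pointwise⇒≡ p)))))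
      (λ p → ≡⇒Pointwise
        (Equivalence.from (fᵥ⇔Shift 2≤n i x y) (e⇒Shift i x y (sym (Pointwise⇒≡ p)))))
  }
  where
  e⇒Shift : ∀ i x y → eᵥ i x ≡ just y → Shift i x y
  e⇒Shift i x y = Equivalence.to (eᵥ⇔Shift 2≤n i x y)

  f⇒Shift : ∀ i x y → fᵥ i y ≡ just x → Shift i x y
  f⇒Shift i x y = Equivalence.to (fᵥ⇔Shift 2≤n i x y)

  ≡⇒Pointwise : ∀ {a b : Maybe (Vec ℕ n)} → a ≡ b → Pointwise _≡_ a b
  ≡⇒Pointwise = Pointwise.reflexive (λ p → p)

  Pointwise⇒≡ : ∀ {a b : Maybe (Vec ℕ n)} → Pointwise _≡_ a b → a ≡ b
  Pointwise⇒≡ (just p) = cong just p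
  Pointwise⇒≡ nothing  = refl

  φ≡ε+φ-ε : ∀ a b → a ≡ b ℤ.+ (a ℤ.- b)
  φ≡ε+φ-ε = solve-∀

-- Exponents of the monomial of a tuple

Y-same : ∀ {n} (i j : Fin n) k → exponent (Y i k) j k ≡ Λ i j
Y-same i j k with i Fin.≟ j | k ℤ.≟ k
... | yes _ | yes _  = refl
... | no _  | yes _  = refl
... | _     | no k≢k = contradiction refl k≢k

Y-distinct : ∀ {n} (i j : Fin n) {k l} → k ≢ l → exponent (Y i k) j l ≡ 0ℤ
Y-distinct i j {k} {l} k≢l with i Fin.≟ j | k ℤ.≟ l
... | _     | yes k≡l = contradiction k≡l k≢l
... | yes _ | no _    = refl
... | no _  | no _    = refl

module _ {n} {j : Fin n} {k : ℤ} where

  ∏-vanish : ∀ {l} (F : Fin l → Monomial n) → (∀ i → exponent (F i) j k ≡ 0ℤ) →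
             exponent (∏ F) j k ≡ 0ℤ
  ∏-vanish {zero}  F F≡0 = refl
  ∏-vanish {suc l} F F≡0 = cong₂ ℤ._+_ (F≡0 Fin.zero) (∏-vanish (F ∘ Fin.suc) (F≡0 ∘ Fin.suc))

  ∏-single : ∀ {l} (F : Fin l → Monomial n) a → (∀ i → i ≢ a → exponent (F i) j k ≡ 0ℤ) →
             exponent (∏ F) j k ≡ exponent (F a) j k
  ∏-single F Fin.zero    F≡0 = trans
    (cong (ℤ._+_ (exponent (F Fin.zero) j k))
      (∏-vanish (F ∘ Fin.suc) λ i → F≡0 (Fin.suc i) λ ()))
    (ℤ.+-identityʳ _)
  ∏-single F (Fin.suc a) F≡0 = trans
    (cong₂ ℤ._+_ (F≡0 Fin.zero λ ())
      (∏-single (F ∘ Fin.suc) a λ i i≢a → F≡0 (Fin.suc i) (i≢a ∘ Fin.suc-injective)))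
    (ℤ.+-identityˡ _)

module _ {n} (x : Vec ℕ n) where

  private
    factor : Fin n → Monomial n
    factor i = Y (prev i) 1ℤ ^ (ℤ.- + lookup x i) · Y i 0ℤ ^ (+ lookup x i)

    factor-0 : ∀ i j → exponent (factor i) j 0ℤ ≡ + lookup x i ℤ.* Λ i j
    factor-0 i j = trans
      (cong₂ (λ a b → ℤ.- + lookup x i ℤ.* a ℤ.+ + lookup x i ℤ.* b)
        (Y-distinct (prev i) j {1ℤ} {0ℤ} λ ()) (Y-same i j 0ℤ))
      (simplify (+ lookup x i) (Λ i j))
      where
      simplify : ∀ a b → ℤ.- a ℤ.* 0ℤ ℤ.+ a ℤ.* b ≡ a ℤ.* b
      simplify = solve-∀

    factor-1 : ∀ i j → exponent (factor i) j 1ℤ ≡ ℤ.- + lookup x i ℤ.* Λ i (next j)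
    factor-1 i j = trans
      (cong₂ (λ a b → ℤ.- + lookup x i ℤ.* a ℤ.+ + lookup x i ℤ.* b)
        (trans (Y-same (prev i) j 1ℤ) (Λ-prev i j)) (Y-distinct i j {0ℤ} {1ℤ} λ ()))
      (simplify (+ lookup x i) (Λ i (next j)))
      where
      simplify : ∀ a b → ℤ.- a ℤ.* b ℤ.+ a ℤ.* 0ℤ ≡ ℤ.- a ℤ.* b
      simplify = solve-∀

    *Λ-same : ∀ a (i : Fin n) → a ℤ.* Λ i i ≡ a
    *Λ-same a i = trans (cong (a ℤ.*_) (Λ-same i)) (ℤ.*-identityʳ a)

    *Λ-distinct : ∀ a {i j : Fin n} → i ≢ j → a ℤ.* Λ i j ≡ 0ℤ
    *Λ-distinct a i≢j = trans (cong (a ℤ.*_) (Λ-distinct i≢j)) (ℤ.*-zeroʳ a)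

  monomial-0 : ∀ j → exponent (monomial x) j 0ℤ ≡ + lookup x j
  monomial-0 j = trans
    (∏-single factor j λ i i≢j → trans (factor-0 i j) (*Λ-distinct (+ lookup x i) i≢j))
    (trans (factor-0 j j) (*Λ-same (+ lookup x j) j))

  -- Yⱼ,₁ occurs only in the factor whose index has predecessor `j`, that is, the factor at
  -- `next j`.
  monomial-1 : ∀ j → exponent (monomial x) j 1ℤ ≡ ℤ.- + lookup x (next j)
  monomial-1 j = trans
    (∏-single factor (next j) λ i i≢ →
      trans (factor-1 i j) (*Λ-distinct (ℤ.- + lookup x i) i≢))
    (trans (factor-1 (next j) j) (*Λ-same (ℤ.- + lookup x (next j)) (next j)))

  monomial-other : ∀ j k → k ≢ 0ℤ → k ≢ 1ℤ → exponent (monomial x) j k ≡ 0ℤ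
  monomial-other j k k≢0 k≢1 = ∏-vanish factor λ i → trans
    (cong₂ (λ a b → ℤ.- + lookup x i ℤ.* a ℤ.+ + lookup x i ℤ.* b)
      (Y-distinct (prev i) j (k≢1 ∘ sym)) (Y-distinct i j (k≢0 ∘ sym)))
    (simplify (+ lookup x i))
    where
    simplify : ∀ a → ℤ.- a ℤ.* 0ℤ ℤ.+ a ℤ.* 0ℤ ≡ 0ℤ
    simplify = solve-∀

-- The exponents at level 0 already recover the tuple.
monomial-injective : ∀ {n} (x y : Vec ℕ n) → monomial x ≈ₘ monomial y → x ≡ y
monomial-injective x y eq = lookup-injective λ j → ℤ.+-injective
  (trans (sym (monomial-0 x j)) (trans (eq j 0ℤ) (monomial-0 y j)))

module _ {n} (i : Fin n) (x y : Vec ℕ n) (shift : Shift i x y) where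

  -- At level 0 the exponents of `A i 0ℤ` are those of the shift, Λᵢ - Λᵢ₊₁. At level 1 they are Λᵢ
  -- - Λᵢ₋₁, the negated shift at the next index. All others vanish.
  monomial-Shift : monomial y ≈ₘ monomial x · A i 0ℤ
  monomial-Shift j k with k ℤ.≟ 0ℤ | k ℤ.≟ 1ℤ
  ... | yes refl | _ = begin
    exponent (monomial y) j 0ℤ                           ≡⟨ monomial-0 y j ⟩
    + lookup y j                                         ≡⟨ shift j ⟩
    -- The zero terms introduced here mirror the four factors of `A i 0ℤ`, so that each can be
    -- replaced by its exponent.
    + lookup x j ℤ.+ (Λ i j ℤ.- Λ (next i) j)            ≡⟨ expand (+ lookup x j) (Λ i j) _ ⟩
    + lookup x j ℤ.+ (Λ i j ℤ.+ 0ℤ ℤ.+ ℤ.-1ℤ ℤ.* 0ℤ ℤ.+ ℤ.-1ℤ ℤ.* Λ (next i) j)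
      ≡⟨ cong₂ ℤ._+_ (monomial-0 x j)
           (cong₂ ℤ._+_
             (cong₂ ℤ._+_
               (cong₂ ℤ._+_ (Y-same i j 0ℤ) (Y-distinct i j {1ℤ} {0ℤ} λ ()))
               (cong (ℤ.-1ℤ ℤ.*_) (Y-distinct (prev i) j {1ℤ} {0ℤ} λ ())))
             (cong (ℤ.-1ℤ ℤ.*_) (Y-same (next i) j 0ℤ))) ⟨
    exponent (monomial x · A i 0ℤ) j 0ℤ                  ∎
    where
    open ≡-Reasoning
    expand : ∀ a b c → a ℤ.+ (b ℤ.- c) ≡ a ℤ.+ (b ℤ.+ 0ℤ ℤ.+ ℤ.-1ℤ ℤ.* 0ℤ ℤ.+ ℤ.-1ℤ ℤ.* c)
    expand = solve-∀
  ... | no _ | yes refl = begin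
    exponent (monomial y) j 1ℤ                           ≡⟨ monomial-1 y j ⟩
    ℤ.- + lookup y (next j)                              ≡⟨ cong ℤ.-_ (shift (next j)) ⟩
    ℤ.- (+ lookup x (next j) ℤ.+ (Λ i (next j) ℤ.- Λ (next i) (next j)))
      ≡⟨ cong₂ (λ a b → ℤ.- (+ lookup x (next j) ℤ.+ (a ℤ.- b))) (sym (Λ-prev i j)) (Λ-next i j) ⟩
    ℤ.- (+ lookup x (next j) ℤ.+ (Λ (prev i) j ℤ.- Λ i j))
      ≡⟨ expand (+ lookup x (next j)) (Λ (prev i) j) (Λ i j) ⟩
    ℤ.- + lookup x (next j) ℤ.+ (0ℤ ℤ.+ Λ i j ℤ.+ ℤ.-1ℤ ℤ.* Λ (prev i) j ℤ.+ ℤ.-1ℤ ℤ.* 0ℤ)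
      ≡⟨ cong₂ ℤ._+_ (monomial-1 x j)
           (cong₂ ℤ._+_
             (cong₂ ℤ._+_
               (cong₂ ℤ._+_ (Y-distinct i j {0ℤ} {1ℤ} λ ()) (Y-same i j 1ℤ))
               (cong (ℤ.-1ℤ ℤ.*_) (Y-same (prev i) j 1ℤ)))
             (cong (ℤ.-1ℤ ℤ.*_) (Y-distinct (next i) j {0ℤ} {1ℤ} λ ()))) ⟨
    exponent (monomial x · A i 0ℤ) j 1ℤ                  ∎
    where
    open ≡-Reasoning
    expand : ∀ a b c → ℤ.- (a ℤ.+ (b ℤ.- c)) ≡
                       ℤ.- a ℤ.+ (0ℤ ℤ.+ c ℤ.+ ℤ.-1ℤ ℤ.* b ℤ.+ ℤ.-1ℤ ℤ.* 0ℤ)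
    expand = solve-∀
  ... | no k≢0 | no k≢1 = trans (monomial-other y j k k≢0 k≢1) (sym
    (cong₂ ℤ._+_ (monomial-other x j k k≢0 k≢1)
      (cong₂ ℤ._+_
        (cong₂ ℤ._+_
          (cong₂ ℤ._+_ (Y-distinct i j (k≢0 ∘ sym)) (Y-distinct i j (k≢1 ∘ sym)))
          (cong (ℤ.-1ℤ ℤ.*_) (Y-distinct (prev i) j (k≢1 ∘ sym))))
        (cong (ℤ.-1ℤ ℤ.*_) (Y-distinct (next i) j (k≢0 ∘ sym))))))

-- Partial sums of exponents and their extrema

0∈window : ∀ N → 0ℤ ∈ window N
0∈window zero    = here refl
0∈window (suc N) = there (there (0∈window N))

-- The extremum for `εₘ` is attained at 1. As `range m` reaches one beyond `bound m`, it contains 1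
-- even for bound 0.
1∈window : ∀ N → 1ℤ ∈ window (suc N)
1∈window zero    = here refl
1∈window (suc N) = there (there (1∈window N))

∑-vanish-∷ : ∀ (g : ℤ → ℤ) {P : Pred ℤ 0ℓ} (P? : Decidable P) k ks → g k ≡ 0ℤ →
             ∑ (List.map g (filter P? (k ∷ ks))) ≡ ∑ (List.map g (filter P? ks))
∑-vanish-∷ g P? k ks gk≡0 with does (P? k)
... | true rewrite gk≡0 = ℤ.+-identityˡ _
... | false = refl

-- The exponents of Yᵢ in m are those of Yᵢ,₀ᵃ Yᵢ,₁⁻ᵇ.
module TwoExponents {n} (m : Monomial n) (i : Fin n) (a b : ℕ)
  (at-0 : exponent m i 0ℤ ≡ + a) (at-1 : exponent m i 1ℤ ≡ ℤ.- + b)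
  (elsewhere : ∀ k → k ≢ 0ℤ → k ≢ 1ℤ → exponent m i k ≡ 0ℤ)
  where

  ∑Y-formula : ∀ {P : Pred ℤ 0ℓ} (P? : Decidable P) →
               ∑Y m i P? ≡ (if does (P? 0ℤ) then + a else 0ℤ) ℤ.+
                           (if does (P? 1ℤ) then ℤ.- + b else 0ℤ)
  -- For bound 0 the window misses 1. The second argument then forces the exponent there, -b, to be
  -- 0, so the formula still holds.
  ∑Y-formula P? = go (bound m) (vanish m i 1ℤ)
    where
    ∑0 : ∑ (List.map (exponent m i) (filter P? (0ℤ ∷ []))) ≡ (if does (P? 0ℤ) then + a else 0ℤ)
    ∑0 with does (P? 0ℤ)
    ... | true  = trans (ℤ.+-identityʳ _) at-0
    ... | false = refl

    go : ∀ N → (N ℕ.< 1 → exponent m i 1ℤ ≡ 0ℤ) →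
         ∑ (List.map (exponent m i) (filter P? (window N))) ≡
           (if does (P? 0ℤ) then + a else 0ℤ) ℤ.+ (if does (P? 1ℤ) then ℤ.- + b else 0ℤ)
    go 0 1-vanishes = trans ∑0 (trans (sym (ℤ.+-identityʳ _))
      (cong (ℤ._+_ (if does (P? 0ℤ) then + a else 0ℤ)) (sym if-0)))
      where
      if-0 : (if does (P? 1ℤ) then ℤ.- + b else 0ℤ) ≡ 0ℤ
      if-0 with does (P? 1ℤ)
      ... | true  = trans (sym at-1) (1-vanishes (s≤s z≤n))
      ... | false = refl
    go 1 _ = trans ∑1 (ℤ.+-comm (if does (P? 1ℤ) then ℤ.- + b else 0ℤ) _)
      where
      rest : ∑ (List.map (exponent m i) (filter P? (-[1+ 0 ] ∷ 0ℤ ∷ []))) ≡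
             (if does (P? 0ℤ) then + a else 0ℤ)
      rest = trans (∑-vanish-∷ (exponent m i) P? -[1+ 0 ] _ (elsewhere _ (λ ()) (λ ()))) ∑0

      ∑1 : ∑ (List.map (exponent m i) (filter P? (window 1))) ≡
           (if does (P? 1ℤ) then ℤ.- + b else 0ℤ) ℤ.+ (if does (P? 0ℤ) then + a else 0ℤ)
      ∑1 with does (P? 1ℤ)
      ... | true  = cong₂ ℤ._+_ at-1 rest
      ... | false = trans rest (sym (ℤ.+-identityˡ _))
    go (suc (suc N)) _ =
      trans (∑-vanish-∷ (exponent m i) P? (+ suc (suc N)) _ (elsewhere _ (λ ()) (λ ())))
      (trans (∑-vanish-∷ (exponent m i) P? -[1+ suc N ] (window (suc N)) (elsewhere _ (λ ()) (λ ())))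
        (go (suc N) λ { (s≤s ()) }))

  wtₘ≡ : wtₘ m i ≡ + a ℤ.- + b
  wtₘ≡ = trans
    -- The unfiltered sum is treated as one filtered by a predicate that always holds.
    (cong (∑ ∘ List.map (exponent m i))
      (sym (filter-all (λ _ → yes tt) (All.universal (λ _ → tt) (window (bound m))))))
    (∑Y-formula {P = λ _ → ⊤} (λ _ → yes tt))

  -- The possible values are a - b, a, -b and 0. The bound holds for every pair of test results,
  -- even the pair that no `k` realises, so the two tests need no comparison.
  -b≤∑≥ : ∀ k → ℤ.- + b ℤ.≤ ∑≥ i m k
  -b≤∑≥ k rewrite ∑Y-formula (λ t → k ℤ.≤? t) with does (k ℤ.≤? 0ℤ) | does (k ℤ.≤? 1ℤ)
  ... | true  | true  = ℤ.i≤j+i (ℤ.- + b) (+ a)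
  ... | true  | false = ℤ.≤-trans ℤ.neg-≤-pos (ℤ.≤-reflexive (sym (ℤ.+-identityʳ (+ a))))
  ... | false | true  = ℤ.≤-reflexive (sym (ℤ.+-identityˡ (ℤ.- + b)))
  ... | false | false = ℤ.neg-≤-pos

  ∑≥-1 : ∑≥ i m 1ℤ ≡ ℤ.- + b
  ∑≥-1 = trans (∑Y-formula (λ t → 1ℤ ℤ.≤? t)) (ℤ.+-identityˡ _)

  ∑≤≤a : ∀ k → ∑≤ i m k ℤ.≤ + a
  ∑≤≤a k rewrite ∑Y-formula (λ t → t ℤ.≤? k) with does (0ℤ ℤ.≤? k) | does (1ℤ ℤ.≤? k)
  ... | true  | true  = ℤ.i-j≤i (+ a) (+ b)
  ... | true  | false = ℤ.≤-reflexive (ℤ.+-identityʳ (+ a))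
  ... | false | true  = ℤ.≤-trans (ℤ.≤-reflexive (ℤ.+-identityˡ (ℤ.- + b))) ℤ.neg-≤-pos
  ... | false | false = +≤+ z≤n

  ∑≤-0 : ∑≤ i m 0ℤ ≡ + a
  ∑≤-0 = trans (∑Y-formula (λ t → t ℤ.≤? 0ℤ)) (ℤ.+-identityʳ _)

  εₘ≡ : εₘ i m ≡ + b
  εₘ≡ = trans (cong ℤ.-_ (min≈v⁺ {xs = List.map (∑≥ i m) (range m)}
      (subst (_∈ List.map (∑≥ i m) (range m)) ∑≥-1 (∈-map⁺ (∑≥ i m) (1∈window (bound m))))
      (All.map⁺ (All.universal -b≤∑≥ (range m)))
      -- The default value 0 of `min` is not below -b either.
      ℤ.neg-≤-pos))
    (ℤ.neg-involutive (+ b))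

  φₘ≡ : φₘ i m ≡ + a
  φₘ≡ = max≈v⁺ {xs = List.map (∑≤ i m) (range m)}
    (subst (_∈ List.map (∑≤ i m) (range m)) ∑≤-0 (∈-map⁺ (∑≤ i m) (0∈window (suc (bound m)))))
    (All.map⁺ (All.universal ∑≤≤a (range m)))
    (+≤+ z≤n)

  -- The minimum -b is attained at 1, and from 2 upwards the partial sum is 0, which differs from -b
  -- as `b` is nonzero.
  kᵉ≡1 : b ≢ 0 → kᵉ i m ≡ 1ℤ
  kᵉ≡1 b≢0 = max≈v⁺
    (∈-filter⁺ (λ k → εₘ i m ℤ.≟ ℤ.- ∑≥ i m k) (1∈window (bound m))
      (trans εₘ≡ (sym (trans (cong ℤ.-_ ∑≥-1) (ℤ.neg-involutive (+ b))))))
    (All.map ≤1 (All.all-filter (λ k → εₘ i m ℤ.≟ ℤ.- ∑≥ i m k) (range m)))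
    -- The default value of `max` is negative, hence below 1.
    -≤+
    where
    ≤1 : ∀ {k} → εₘ i m ≡ ℤ.- ∑≥ i m k → k ℤ.≤ 1ℤ
    ≤1 {+ 0}           _  = +≤+ z≤n
    ≤1 {+ 1}           _  = +≤+ (s≤s z≤n)
    ≤1 { -[1+ _ ]}     _  = -≤+
    ≤1 {+ suc (suc k)} eq = contradiction
      (ℤ.+-injective (trans (sym εₘ≡)
        (trans eq (cong ℤ.-_ (∑Y-formula (λ t → + suc (suc k) ℤ.≤? t)))))) b≢0

  -- For negative `k` the partial sum is 0, which is not the maximum `a`; at 0 the maximum is
  -- attained.
  kᶠ≡0 : a ≢ 0 → kᶠ i m ≡ 0ℤ
  kᶠ≡0 a≢0 = min≈v⁺
    (∈-filter⁺ (λ k → φₘ i m ℤ.≟ ∑≤ i m k) (0∈window (suc (bound m)))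
      (trans φₘ≡ (sym ∑≤-0)))
    (All.map 0≤ (All.all-filter (λ k → φₘ i m ℤ.≟ ∑≤ i m k) (range m)))
    (+≤+ z≤n)
    where
    0≤ : ∀ {k} → φₘ i m ≡ ∑≤ i m k → 0ℤ ℤ.≤ k
    0≤ {+ _}       _  = +≤+ z≤n
    0≤ { -[1+ k ]} eq = contradiction
      (ℤ.+-injective (trans (sym φₘ≡) (trans eq (∑Y-formula (λ t → t ℤ.≤? -[1+ k ]))))) a≢0

-- Operators on monomials against operators on tuples

if-nothing : ∀ {A B P Q : Set} {R : REL A B 0ℓ} {u v} (P? : Dec P) (Q? : Dec Q) →
             (P → Q) → (Q → P) → (¬ Q → R u v) →
             Pointwise R (if isYes P? then nothing else just u)
                         (if isYes Q? then nothing else just v)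
if-nothing (yes _) (yes _) _ _ _ = nothing
if-nothing (yes p) (no ¬q) f _ _ = contradiction (f p) ¬q
if-nothing (no ¬p) (yes q) _ g _ = contradiction (g q) ¬p
if-nothing (no _)  (no ¬q) _ _ r = just (r ¬q)

module _ {n} (x : Vec ℕ n) (m : Monomial n) (m≈x : m ≈ₘ monomial x) (i : Fin n) where

  private
    module m = TwoExponents m i (lookup x i) (lookup x (next i))
      (trans (m≈x i 0ℤ) (monomial-0 x i)) (trans (m≈x i 1ℤ) (monomial-1 x i))
      (λ k k≢0 k≢1 → trans (m≈x i k) (monomial-other x i k k≢0 k≢1))

  wtₘ-monomial : wtₘ m i ≡ RawCrystal.wt (tuples n) x i
  wtₘ-monomial = m.wtₘ≡

  εₘ-monomial : εₘ i m ≡ εᵥ i x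
  εₘ-monomial = m.εₘ≡

  φₘ-monomial : φₘ i m ≡ φᵥ i x
  φₘ-monomial = m.φₘ≡

  eₘ-monomial : 2 ≤ n → Pointwise (λ m′ y → m′ ≈ₘ monomial y) (eₘ i m) (eᵥ i x)
  eₘ-monomial 2≤n = if-nothing (εₘ i m ℤ.≟ 0ℤ) (lookup x (next i) ℕ.≟ 0)
    (ℤ.+-injective ∘ trans (sym m.εₘ≡)) (trans m.εₘ≡ ∘ cong +_)
    λ ≢0 j k → trans
      -- Since `kᵉ i m` is 1, its predecessor computes to 0 and the factor is `A i 0ℤ`.
      (cong₂ ℤ._+_ (m≈x j k) (cong (λ l → exponent (A i (ℤ.pred l)) j k) (m.kᵉ≡1 ≢0)))
      (sym (monomial-Shift i x y (e-Shift i x (next-≢ 2≤n i ∘ sym) ≢0) j k))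
    where
    y : Vec ℕ n
    y = updateAt (updateAt x i suc) (next i) ℕ.pred

  fₘ-monomial : Pointwise (λ m′ y → m′ ≈ₘ monomial y) (fₘ i m) (fᵥ i x)
  fₘ-monomial = if-nothing (φₘ i m ℤ.≟ 0ℤ) (lookup x i ℕ.≟ 0)
    (ℤ.+-injective ∘ trans (sym m.φₘ≡)) (trans m.φₘ≡ ∘ cong +_)
    λ ≢0 j k → trans
      -- The shift leads from the result `y` up to `x`, so `m` is `monomial y · A i 0ℤ`, and the
      -- inverse factor cancels.
      (cong₂ ℤ._+_ (trans (m≈x j k) (monomial-Shift i y x (f-Shift i x ≢0) j k))
                   (cong (λ l → ℤ.-1ℤ ℤ.* exponent (A i l) j k) (m.kᶠ≡0 ≢0)))
      (cancel (exponent (monomial y) j k) (exponent (A i 0ℤ) j k))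
    where
    y : Vec ℕ n
    y = updateAt (updateAt x i ℕ.pred) (next i) suc
    cancel : ∀ a b → a ℤ.+ b ℤ.+ ℤ.-1ℤ ℤ.* b ≡ a
    cancel = solve-∀

-- The isomorphism

module _ {n} (s : ℕ) (2≤n : 2 ≤ n) where

  private
    All-monomial : ∀ {a b} → Pointwise (λ m x → m ≈ₘ monomial x) a b →
                   MaybeAll.All (λ x → Vec.sum x ≡ s) b → MaybeAll.All (𝓜¹ n s) a
    All-monomial (just {y = x} m≈x) (just sum≡s) = just (x , sum≡s , m≈x)
    All-monomial nothing    nothing      = nothing

  𝓜¹-closed : Closed (𝓜 n) (𝓜¹ n s)
  𝓜¹-closed i m (x , sum≡s , m≈x) =
    All-monomial (eₘ-monomial x m m≈x i 2≤n) (proj₁ (tuples-closed n s i x sum≡s)) ,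
    All-monomial (fₘ-monomial x m m≈x i)     (proj₂ (tuples-closed n s i x sum≡s))

  private
    C D : RawCrystal n
    C = restrict (𝓜 n) 𝓜¹-closed
    D = B¹ n s
    module C = RawCrystal C
    module D = RawCrystal D

    ≈ₘ-isEquivalence : IsEquivalence (_≈ₘ_ {n})
    ≈ₘ-isEquivalence = record
      { refl  = λ _ _ → refl
      ; sym   = λ p i k → sym (p i k)
      ; trans = λ p q i k → trans (p i k) (q i k)
      }

    -- Membership in `𝓜¹` carries the tuple as a witness. Equal monomials may come with separate
    -- witnesses, so `to-cong` rests on `monomial-injective`.
    to : C.Carrier → D.Carrier
    to (_ , x , sum≡s , _) = x , sum≡s

    to-cong : Congruent C._≈_ D._≈_ to
    to-cong {m , x , _ , m≈x} {m′ , x′ , _ , m′≈x′} m≈m′ = monomial-injective x x′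
      λ i k → trans (sym (m≈x i k)) (trans (m≈m′ i k) (m′≈x′ i k))

    to-injective : Injective C._≈_ D._≈_ to
    to-injective {m , x , _ , m≈x} {m′ , .x , _ , m′≈x} refl i k =
      trans (m≈x i k) (sym (m′≈x i k))

    -- The tuple stored in `p` is not given as the result `y` of the tuple operator; both describe
    -- the same monomial, so injectivity identifies them.
    to-attach : ∀ {a b} (p : MaybeAll.All (𝓜¹ n s) a) (q : MaybeAll.All (λ x → Vec.sum x ≡ s) b) →
                Pointwise (λ m x → m ≈ₘ monomial x) a b →
                Pointwise D._≈_ (attach b q) (Maybe.map to (attach a p))
    to-attach nothing nothing nothing = nothing
    to-attach {just m} {just y} (just (x , _ , m≈x)) (just _) (just m≈y) = just
      (monomial-injective y x λ i k → trans (sym (m≈y i k)) (m≈x i k))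

    wt-to : ∀ b i → D.wt (to b) i ≡ C.wt b i
    wt-to (m , x , _ , m≈x) i = sym (wtₘ-monomial x m m≈x i)

    ε-to : ∀ i b → D.ε i (to b) ≡ C.ε i b
    ε-to i (m , x , _ , m≈x) = sym (εₘ-monomial x m m≈x i)

    φ-to : ∀ i b → D.φ i (to b) ≡ C.φ i b
    φ-to i (m , x , _ , m≈x) = sym (φₘ-monomial x m m≈x i)

    e-to : ∀ i b → Pointwise D._≈_ (D.e i (to b)) (Maybe.map to (C.e i b))
    e-to i (m , x , _ , m≈x) = to-attach _ _ (eₘ-monomial x m m≈x i 2≤n)

    f-to : ∀ i b → Pointwise D._≈_ (D.f i (to b)) (Maybe.map to (C.f i b))
    f-to i (m , x , _ , m≈x) = to-attach _ _ (fₘ-monomial x m m≈x i)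

    D-isCrystal : IsCrystal D
    D-isCrystal = restrict-isCrystal (tuples-isCrystal 2≤n) (tuples-closed n s)

  𝓜¹≅B¹ : restrict (𝓜 n) 𝓜¹-closed ≅ B¹ n s
  𝓜¹≅B¹ = record
    { isCrystalˡ = Embedding.isCrystal-via-embedding C D D-isCrystal
        (On.isEquivalence proj₁ ≈ₘ-isEquivalence)
        to (λ {b} {b′} → to-cong {b} {b′}) (λ {b} {b′} → to-injective {b} {b′})
        wt-to ε-to φ-to e-to f-to
    ; isCrystalʳ = D-isCrystal
    ; to         = to
    ; to-cong    = λ {b} {b′} → to-cong {b} {b′}
    ; bijective  = (λ {b} {b′} → to-injective {b} {b′}) , λ (x , sum≡s) →
        -- Surjectivity asks that everything equivalent to the preimage `b` be sent to the given
        -- tuple, hence the appeal to `to-cong`.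
        let b = monomial x , x , sum≡s , λ _ _ → refl
        in b , λ {b′} b′≈b → to-cong {b′} {b} b′≈b
    ; wt-to = wt-to
    ; ε-to  = ε-to
    ; φ-to  = φ-to
    ; e-to  = e-to
    ; f-to  = f-to
    }

theorem3p1 : (n s : ℕ) → 3 ≤ n → 1 ≤ s →
    Σ[ closed ∈ Closed (𝓜 n) (𝓜¹ n s) ] restrict (𝓜 n) closed ≅ B¹ n s
theorem3p1 n s 3≤n _ = 𝓜¹-closed s 2≤n , 𝓜¹≅B¹ s 2≤n
  where
  2≤n : 2 ≤ n
  2≤n = ℕ.≤-trans (ℕ.n≤1+n 2) 3≤n
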